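{- For all $n\ge2$ and $r\in\{1,2,n\}$, $$|S_{n,r}(3412,3421)|=\mathbb{S}_{n-2};$$ and for all $n\ge4$ and $2<r<n$, $$|S_{n,r}(3412,3421)|=\mathbb{S}_{r-2}\,\mathbb{S}_{n-r},$$ where $\mathbb{S}_m$ is the $m$th large Schr\"oder number.
   Context: $S_n$ is the set of permutations of $\{1,\ldots,n\}$ written as sequences $(\tau(1),\ldots,\tau(n))$. A permutation $\tau\in S_n$ contains $\sigma\in S_k$ as a pattern if there are indices $1\le i_1<\cdots<i_k\le n$ such that for all $1\le a<b\le k$, $\tau(i_a)<\tau(i_b)$ if and only if $\sigma(a)<\sigma(b)$; otherwise $\tau$ avoids $\sigma$. $S_{n,r}(\sigma_1,\ldots,\sigma_m)$ is the set of $\tau\in S_n$ with $\tau(1)=r$ that avoid all of $\sigma_1,\ldots,\sigma_m$. The large (big) Schr\"oder number $\mathbb{S}_m$, $m\ge0$, is the number of lattice paths from $(0,0)$ to $(m,m)$ with steps $(1,0),(0,1),(1,1)$ that never go above the line $y=x$; the sequence begins $\mathbb{S}_0=1,\ \mathbb{S}_1=2,\ \mathbb{S}_2=6,\ \mathbb{S}_3=22,\ \mathbb{S}_4=90,\ldots$ (OEIS A006318). -}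

module Defs where

open import Data.Empty using (⊥)
open import Data.Fin using (Fin; zero; suc; toℕ; _<_; #_)
open import Data.Fin.Permutation using (Permutation′; permutation; _⟨$⟩ʳ_; _≈_)
open import Data.Fin.Properties using (_≟_; all?; 0↔⊥; 1↔⊤; +↔⊎; *↔×)
open import Data.List using (List; []; _∷_; map)
open import Data.List.Relation.Unary.All using (All)
open import Data.Nat using (ℕ; zero; suc; _+_; _*_; _≤_; _≤?_)
open import Data.Nat.Properties using (≤-irrelevant)
open import Data.Product using (Σ; ∃; _×_; _,_; proj₁; proj₂)
open import Data.Product.Function.NonDependent.Propositional using (_×-↔_)
open import Data.Sum using (_⊎_; inj₁; inj₂)
open import Data.Sum.Function.Propositional using (_⊎-↔_)
open import Data.Unit using (⊤; tt)
open import Data.Vec using (Vec; []; _∷_; lookup)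
open import Function using (_⇔_; _↔_; mk↔ₛ′; Inverse)
open import Function.Construct.Composition using (_↔-∘_)
open import Function.Construct.Symmetry using (↔-sym)
open import Level using (0ℓ)
open import Relation.Binary using (Setoid)
open import Relation.Binary.PropositionalEquality using (_≡_; refl; sym; trans; cong; setoid)
open import Relation.Nullary using (¬_; yes; no; contradiction)
open import Relation.Nullary.Decidable using (from-yes)

-- Cardinality is taken in setoids, so that permutations that agree pointwise
-- are counted once.

∣_∣≡_ : Setoid 0ℓ 0ℓ → ℕ → Set
∣ S ∣≡ k = Inverse S (setoid (Fin k))

Contains : ∀ {n k} → Permutation′ n → Permutation′ k → Set
Contains {n} {k} τ σ = ∃ λ (ι : Fin k → Fin n) →
  (∀ a b → a < b → ι a < ι b) ×
  (∀ a b → a < b → ((τ ⟨$⟩ʳ ι a) < (τ ⟨$⟩ʳ ι b)) ⇔ ((σ ⟨$⟩ʳ a) < (σ ⟨$⟩ʳ b)))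

Avoids : ∀ {n k} → Permutation′ n → Permutation′ k → Set
Avoids τ σ = ¬ Contains τ σ

-- Fin n is 0-based: the element i stands for suc (toℕ i) in {1, …, n}, both as
-- a position and as a value.  This is "τ(p) = v" in the 1-based convention.

_at_is_ : ∀ {n} → Permutation′ n → ℕ → ℕ → Set
τ at p is v = ∃ λ i → suc (toℕ i) ≡ p × suc (toℕ (τ ⟨$⟩ʳ i)) ≡ v

Pattern : Set
Pattern = ∃ Permutation′

S : (n r : ℕ) → List Pattern → Setoid 0ℓ 0ℓ
S n r σs = record
  { Carrier       = Σ (Permutation′ n) λ τ →
                      τ at 1 is r × All (λ σ → Avoids τ (proj₂ σ)) σs
  ; _≈_           = λ τ ρ → proj₁ τ ≈ proj₁ ρ
  ; isEquivalence = record
    { refl  = λ _ → refl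
    ; sym   = λ e i → sym (e i)
    ; trans = λ e f i → trans (e i) (f i)
    }
  }

-- The two patterns in 0-based one-line notation, each with its inverse.

p3412 : Pattern
p3412 = 4 , permutation (lookup w) (lookup w)
  (from-yes (all? λ i → lookup w (lookup w i) ≟ i))
  (from-yes (all? λ i → lookup w (lookup w i) ≟ i))
  where
  w : Vec (Fin 4) 4
  w = # 2 ∷ # 3 ∷ # 0 ∷ # 1 ∷ []

p3421 : Pattern
p3421 = 4 , permutation (lookup w) (lookup w⁻¹)
  (from-yes (all? λ i → lookup w (lookup w⁻¹ i) ≟ i))
  (from-yes (all? λ i → lookup w⁻¹ (lookup w i) ≟ i))
  where
  w w⁻¹ : Vec (Fin 4) 4
  w   = # 2 ∷ # 3 ∷ # 1 ∷ # 0 ∷ []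
  w⁻¹ = # 3 ∷ # 2 ∷ # 0 ∷ # 1 ∷ []

-- Path x y: lattice paths from (0,0) to (x,y), with steps (1,0), (0,1), (1,1),
-- that never go above the diagonal.  Only a (0,1) step can cross the diagonal
-- from a point weakly below it, so only that step carries the condition.

data Path : ℕ → ℕ → Set where
  start : Path 0 0
  east  : ∀ {x y} → Path x y → Path (suc x) y
  north : ∀ {x y} → suc y ≤ x → Path x y → Path x (suc y)
  diag  : ∀ {x y} → Path x y → Path (suc x) (suc y)

Finite : Set → Set
Finite A = ∃ λ k → ∣ setoid A ∣≡ k

resp : ∀ {A B : Set} → A ↔ B → Finite B → Finite A
resp f (k , g) = k , g ↔-∘ f

⊎-finite : ∀ {A B : Set} → Finite A → Finite B → Finite (A ⊎ B)
⊎-finite (j , f) (k , g) = j + k , ↔-sym +↔⊎ ↔-∘ (f ⊎-↔ g)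

×-finite : ∀ {A B : Set} → Finite A → Finite B → Finite (A × B)
×-finite (j , f) (k , g) = j * k , ↔-sym *↔× ↔-∘ (f ×-↔ g)

⊥-finite : Finite ⊥
⊥-finite = 0 , ↔-sym 0↔⊥

⊤-finite : Finite ⊤
⊤-finite = 1 , ↔-sym 1↔⊤

≤-finite : ∀ m n → Finite (m ≤ n)
≤-finite m n with m ≤? n
... | yes p = resp (mk↔ₛ′ (λ _ → tt) (λ _ → p) (λ _ → refl) (≤-irrelevant p)) ⊤-finite
... | no ¬p = resp (mk↔ₛ′ ¬p (λ ()) (λ ()) (λ p → contradiction p ¬p)) ⊥-finite

path₀₀ : Path 0 0 ↔ ⊤
path₀₀ = mk↔ₛ′ (λ { start → tt }) (λ { tt → start })
  (λ { tt → refl }) (λ { start → refl })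

pathₛ₀ : ∀ {x} → Path (suc x) 0 ↔ Path x 0
pathₛ₀ = mk↔ₛ′ (λ { (east p) → p }) east (λ _ → refl) (λ { (east p) → refl })

path₀ₛ : ∀ {y} → Path 0 (suc y) ↔ ⊥
path₀ₛ = mk↔ₛ′ (λ { (north () _) }) (λ ()) (λ ()) (λ { (north () _) })

pathₛₛ : ∀ {x y} → Path (suc x) (suc y) ↔
         (Path x (suc y) ⊎ (suc y ≤ suc x × Path (suc x) y) ⊎ Path x y)
pathₛₛ = mk↔ₛ′
  (λ { (east p) → inj₁ p ; (north l p) → inj₂ (inj₁ (l , p)) ; (diag p) → inj₂ (inj₂ p) })
  (λ { (inj₁ p) → east p ; (inj₂ (inj₁ (l , p))) → north l p ; (inj₂ (inj₂ p)) → diag p })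
  (λ { (inj₁ p) → refl ; (inj₂ (inj₁ (l , p))) → refl ; (inj₂ (inj₂ p)) → refl })
  (λ { (east p) → refl ; (north l p) → refl ; (diag p) → refl })

paths-finite : ∀ x y → ∃ λ k → ∣ setoid (Path x y) ∣≡ k
paths-finite zero    zero    = resp path₀₀ ⊤-finite
paths-finite (suc x) zero    = resp pathₛ₀ (paths-finite x zero)
paths-finite zero    (suc y) = resp path₀ₛ ⊥-finite
paths-finite (suc x) (suc y) = resp pathₛₛ
  (⊎-finite (paths-finite x (suc y))
    (⊎-finite (×-finite (≤-finite (suc y) (suc x)) (paths-finite (suc x) y))
      (paths-finite x y)))

𝕊 : ℕ → ℕ
𝕊 m = proj₁ (paths-finite m m)

𝕊-counts-paths : ∀ m → ∣ setoid (Path m m) ∣≡ 𝕊 m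
𝕊-counts-paths m = proj₂ (paths-finite m m)

_ : map 𝕊 (0 ∷ 1 ∷ 2 ∷ 3 ∷ 4 ∷ []) ≡ 1 ∷ 2 ∷ 6 ∷ 22 ∷ 90 ∷ []
_ = refl

{-# OPTIONS --safe #-}
module Submission where

-- Write a permutation by its Lehmer code: the entry at position i is the number
-- of later values smaller than τ(i).  Then τ avoids 3412 and 3421 iff every code
-- entry c is followed by c − 1 entries bounded by c − 1, c − 2, …, 1.  Read from
-- the left, these bounds say that the code of τ with τ(1) = r ≥ 2 is the entry
-- r − 1, followed by the code of an avoider of length r − 1 without its final 0,
-- followed by the code of an avoider of length n − r + 1; the two parts are
-- independent.  Hence the numbers b(n) of avoiders of length n + 1 satisfy
-- b(n + 1) = b(n) + Σ b(c) b(n − c).  The Schröder paths satisfy the same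
-- recurrence, because the paths to distance d + 1 below the diagonal are the
-- convolution of those to distance d with those to the diagonal.

open import Defs
open import Data.Empty using (⊥)
open import Data.Fin as Fin using (Fin; #_; zero; suc; toℕ; fromℕ<; punchIn)
open import Data.Fin.Permutation as Perm
  using (Permutation′; _⟨$⟩ʳ_; _⟨$⟩ˡ_; _≈_; remove; insert; punchIn-permute; remove-insert)
open import Data.Fin.Properties
  using (toℕ<n; toℕ-fromℕ<; toℕ-injective; punchInᵢ≢i; punchIn-cancel-≤; punchIn-injective;
         punchIn-mono-≤; +↔⊎; *↔×; 0≢1+n; suc-injective)
open import Data.List using ([]; _∷_)
open import Data.List.Relation.Unary.All using ([]; _∷_)
open import Data.Nat
  using (ℕ; zero; suc; pred; _+_; _*_; _∸_; _≤_; _<_; z≤n; s≤s; z<s; s<s; s≤s⁻¹; _≤?_; _<?_)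
open import Data.Nat.Induction using (<-rec)
open import Data.Nat.Properties hiding (suc-injective; 0≢1+n)
open import Data.Product using (Σ; ∃; _×_; _,_; proj₁; proj₂)
open import Data.Product.Function.NonDependent.Propositional using (_×-↔_)
open import Data.Sum using (_⊎_; inj₁; inj₂)
open import Data.Sum.Function.Propositional using (_⊎-↔_)
open import Data.Unit using (⊤; tt)
open import Data.Vec using (Vec; []; _∷_; _++_; lookup; take; drop)
open import Data.Vec.Properties using (∷-injective; take++drop≡id; ++-injective)
open import Function using (_∘_; _↔_; _⇔_; mk⇔; mk↔ₛ′; Inverse; Equivalence)
open import Function.Construct.Composition using (_↔-∘_; inverse)
open import Function.Construct.Symmetry using (↔-sym)
open import Relation.Binary using (Setoid)
open import Relation.Binary.Definitions using (tri<; tri≈; tri>)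
open import Relation.Binary.PropositionalEquality
  using (_≡_; _≢_; refl; sym; trans; cong; cong₂; subst; subst₂; setoid; module ≡-Reasoning)
open import Relation.Nullary using (¬_; yes; no; contradiction)
open import Relation.Nullary.Decidable using (from-yes)
open import Relation.Nullary.Irrelevant using (Irrelevant)
open import Algebra.Properties.Semiring.Sum +-*-semiring using (sum; sum-cong-≗; ∑-distrib-+)

-- Schröder paths

#path : ℕ → ℕ → ℕ
#path x y = proj₁ (paths-finite x y)

-- The condition on a north step enters the path count as a factor that is 1 or 0.
≤-count-yes : ∀ {m n} → m ≤ n → proj₁ (≤-finite m n) ≡ 1
≤-count-yes {m} {n} m≤n with m ≤? n
... | yes _   = refl
... | no  m≰n = contradiction m≤n m≰n

≤-count-no : ∀ {m n} → n < m → proj₁ (≤-finite m n) ≡ 0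
≤-count-no {m} {n} n<m with m ≤? n
... | yes m≤n = contradiction m≤n (<⇒≱ n<m)
... | no  _   = refl

#path-above : ∀ {x y} → x < y → #path x y ≡ 0
#path-above {zero}  {suc y} _         = refl
#path-above {suc x} {suc y} (s<s x<y)
  rewrite #path-above (m<n⇒m<1+n x<y) | ≤-count-no (s<s x<y) | #path-above x<y = refl

#path-step : ∀ {x y} → y ≤ x →
  #path (suc x) (suc y) ≡ #path x (suc y) + (#path (suc x) y + #path x y)
#path-step {x} {y} y≤x rewrite ≤-count-yes (s≤s y≤x) | *-identityˡ (#path (suc x) y) = refl

#offset : ℕ → ℕ → ℕ
#offset d y = #path (d + y) y

#offset-zero : ∀ d → #offset d 0 ≡ 1
#offset-zero zero    = refl
#offset-zero (suc d) = #offset-zero d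

-- An east step onto the diagonal would start above it, where there are no paths.
#offset-diagonal : ∀ y → 𝕊 (suc y) ≡ #offset 1 y + 𝕊 y
#offset-diagonal y =
  trans (#path-step (≤-refl {y})) (cong (_+ (#offset 1 y + 𝕊 y)) (#path-above (n<1+n y)))

#offset-step : ∀ d y →
  #offset (suc d) (suc y) ≡ #offset d (suc y) + (#offset (2 + d) y + #offset (suc d) y)
#offset-step d y = trans (#path-step (≤-trans (n≤1+n y) (m≤n+m (suc y) d)))
  (cong (λ x → #offset d (suc y) + (#path (suc x) y + #path x y)) (+-suc d y))

convolve : (ℕ → ℕ) → ℕ → ℕ
convolve f n = sum {suc n} λ i → f (toℕ i) * 𝕊 (n ∸ toℕ i)

convolve-cong : ∀ {f g} → (∀ i → f i ≡ g i) → ∀ n → convolve f n ≡ convolve g n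
convolve-cong f≗g n = sum-cong-≗ {suc n} λ i → cong (_* 𝕊 (n ∸ toℕ i)) (f≗g (toℕ i))

convolve-+ : ∀ f g n → convolve (λ i → f i + g i) n ≡ convolve f n + convolve g n
convolve-+ f g n = trans
  (sum-cong-≗ {suc n} λ i → *-distribʳ-+ (𝕊 (n ∸ toℕ i)) (f (toℕ i)) (g (toℕ i)))
  (∑-distrib-+ {suc n} (λ i → f (toℕ i) * 𝕊 (n ∸ toℕ i)) (λ i → g (toℕ i) * 𝕊 (n ∸ toℕ i)))

-- The recurrence `#offset-step` is linear, so it carries over to convolutions with `𝕊`. It trades
-- height for distance, hence the induction is on `y` first and on `d` second.
#offset-convolve : ∀ y d → #offset (suc d) y ≡ convolve (#offset d) y
#offset-convolve zero d = sym (trans (+-identityʳ _) (*-identityʳ _))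
#offset-convolve (suc y) zero = begin
  #offset 1 (suc y)
    ≡⟨ #offset-step 0 y ⟩
  𝕊 (suc y) + (#offset 2 y + #offset 1 y)
    -- The factor 1 is `𝕊 0`: this term is the summand of `convolve 𝕊 (suc y)` at index 0, and
    -- `#offset-diagonal` accounts for the later ones.
    ≡⟨ cong₂ _+_ (sym (*-identityˡ (𝕊 (suc y))))
         (cong₂ _+_ (#offset-convolve y 1) (#offset-convolve y 0)) ⟩
  1 * 𝕊 (suc y) + (convolve (#offset 1) y + convolve 𝕊 y)
    ≡⟨ cong (1 * 𝕊 (suc y) +_) (convolve-+ (#offset 1) 𝕊 y) ⟨
  1 * 𝕊 (suc y) + convolve (λ i → #offset 1 i + 𝕊 i) y
    ≡⟨ cong (1 * 𝕊 (suc y) +_) (convolve-cong #offset-diagonal y) ⟨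
  convolve 𝕊 (suc y) ∎
  where open ≡-Reasoning
#offset-convolve (suc y) (suc d) = begin
  #offset (2 + d) (suc y)
    ≡⟨ #offset-step (suc d) y ⟩
  #offset (suc d) (suc y) + (#offset (3 + d) y + #offset (2 + d) y)
    ≡⟨ cong₂ _+_ (#offset-convolve (suc y) d)
         (cong₂ _+_ (#offset-convolve y (2 + d)) (#offset-convolve y (suc d))) ⟩
  (first + convolve (#offset d ∘ suc) y)
    + (convolve (#offset (2 + d)) y + convolve (#offset (suc d)) y)
    ≡⟨ +-assoc first _ _ ⟩
  first + (convolve (#offset d ∘ suc) y
    + (convolve (#offset (2 + d)) y + convolve (#offset (suc d)) y))
    ≡⟨ cong (λ c → first + (convolve (#offset d ∘ suc) y + c))
         (convolve-+ (#offset (2 + d)) (#offset (suc d)) y) ⟨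
  first + (convolve (#offset d ∘ suc) y
    + convolve (λ i → #offset (2 + d) i + #offset (suc d) i) y)
    ≡⟨ cong (first +_) (convolve-+ (#offset d ∘ suc) (λ i → #offset (2 + d) i + #offset (suc d) i) y) ⟨
  first + convolve (λ i → #offset d (suc i) + (#offset (2 + d) i + #offset (suc d) i)) y
    ≡⟨ cong (first +_) (convolve-cong (#offset-step d) y) ⟨
  convolve (#offset (suc d)) (suc y) ∎
  where
  open ≡-Reasoning
  first = #offset d 0 * 𝕊 (suc y)

𝕊-recurrence : ∀ n → 𝕊 (suc n) ≡ 𝕊 n + convolve 𝕊 n
𝕊-recurrence n = trans (#offset-diagonal n)
  (trans (+-comm (#offset 1 n) (𝕊 n)) (cong (𝕊 n +_) (#offset-convolve n 0)))

-- Codes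

-- In a code the empty word never meets a positive bound: an entry exceeds the number of listed
-- entries behind it by at most one, so its window of `pred d` entries fits.
Bounded : ∀ {n} → ℕ → Vec ℕ n → Set
Bounded zero    _       = ⊤
Bounded (suc c) []      = ⊥
Bounded (suc c) (d ∷ w) = d ≤ suc c × Bounded c w

-- A permutation of length n + 1 has a code of length n: the last entry, always 0,
-- is omitted.
Valid : ∀ {n} → Vec ℕ n → Set
Valid []              = ⊤
Valid {suc n} (d ∷ w) = d < 2 + n × Bounded (pred d) w × Valid w

Code : ℕ → Set
Code n = Σ (Vec ℕ n) Valid

-- Tail n k: what can follow the entry k in a code of length n + 1.
Tail : ℕ → ℕ → Set
Tail n k = Σ (Vec ℕ n) λ w → Bounded (pred k) w × Valid w

Bounded-irrelevant : ∀ {n} c (w : Vec ℕ n) → Irrelevant (Bounded c w)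
Bounded-irrelevant zero    _       _       _       = refl
Bounded-irrelevant (suc c) (d ∷ w) (p , q) (r , s) =
  cong₂ _,_ (≤-irrelevant p r) (Bounded-irrelevant c w q s)

Valid-irrelevant : ∀ {n} (w : Vec ℕ n) → Irrelevant (Valid w)
Valid-irrelevant []      _           _              = refl
Valid-irrelevant (d ∷ w) (p , q , r) (p′ , q′ , r′) = cong₂ _,_ (<-irrelevant p p′)
  (cong₂ _,_ (Bounded-irrelevant (pred d) w q q′) (Valid-irrelevant w r r′))

subset-≡ : ∀ {A : Set} {P : A → Set} → (∀ a → Irrelevant (P a)) →
  {x y : Σ A P} → proj₁ x ≡ proj₁ y → x ≡ y
subset-≡ irr {a , p} {_ , q} refl = cong (a ,_) (irr a p q)

Code-≡ : ∀ {n} {x y : Code n} → proj₁ x ≡ proj₁ y → x ≡ y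
Code-≡ = subset-≡ Valid-irrelevant

Tail-≡ : ∀ {n k} {x y : Tail n k} → proj₁ x ≡ proj₁ y → x ≡ y
Tail-≡ {k = k} = subset-≡ λ { w (p , q) (p′ , q′) →
  cong₂ _,_ (Bounded-irrelevant (pred k) w p p′) (Valid-irrelevant w q q′) }

Bounded-++⁺ : ∀ {m n} e (u : Vec ℕ m) {v : Vec ℕ n} → Bounded e u → Bounded e (u ++ v)
Bounded-++⁺ zero    _       _       = tt
Bounded-++⁺ (suc e) (d ∷ u) (p , q) = p , Bounded-++⁺ e u q

Bounded-++⁻ : ∀ {m n} e (u : Vec ℕ m) {v : Vec ℕ n} → e ≤ m → Bounded e (u ++ v) → Bounded e u
Bounded-++⁻ zero    _       _         _       = tt
Bounded-++⁻ (suc e) (d ∷ u) (s≤s e≤m) (p , q) = p , Bounded-++⁻ e u e≤m q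

-- The size conditions on a code of length `m` bound its entries by `m`, ..., 1, which is exactly
-- `Bounded m`. They also make every window opened in `u` close inside `u`, so `u` imposes nothing
-- on `v`.
Valid-++⁺ : ∀ {m n} (u : Vec ℕ m) {v : Vec ℕ n} → Valid u → Valid v →
  Bounded m (u ++ v) × Valid (u ++ v)
Valid-++⁺         []      _           y = tt , y
Valid-++⁺ {suc m} (d ∷ u) (p , q , x) y with b , z ← Valid-++⁺ u x y =
  (s≤s⁻¹ p , b) , (<-≤-trans p (s≤s (s≤s (m≤m+n m _))) , Bounded-++⁺ (pred d) u q , z)

Valid-++⁻ : ∀ {m n} (u : Vec ℕ m) {v : Vec ℕ n} → Bounded m (u ++ v) → Valid (u ++ v) →
  Valid u × Valid v
Valid-++⁻ []      _       z           = tt , z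
-- The size condition for `u ++ v` is too weak for `u`; the sharper one comes from `Bounded m`.
Valid-++⁻ (d ∷ u) (p , b) (_ , q , z) with x , y ← Valid-++⁻ u b z =
  (s≤s p , Bounded-++⁻ (pred d) u (pred-mono-≤ p) q , x) , y

Tail-split : ∀ c m → Tail (c + m) (suc c) ↔ (Code c × Code m)
Tail-split c m = mk↔ₛ′ to from to∘from (λ x → Tail-≡ {k = suc c} (take++drop≡id c (proj₁ x)))
  where
  to : Tail (c + m) (suc c) → Code c × Code m
  to (w , b , z) = (take c w , proj₁ parts) , (drop c w , proj₂ parts)
    where
    w≡ = sym (take++drop≡id c w)
    parts = Valid-++⁻ (take c w) (subst (Bounded c) w≡ b) (subst Valid w≡ z)

  from : Code c × Code m → Tail (c + m) (suc c)
  from ((u , x) , (v , y)) = u ++ v , Valid-++⁺ u x y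

  to∘from : ∀ x → to (from x) ≡ x
  to∘from ((u , x) , (v , y)) with ++-injective (take c (u ++ v)) u (take++drop≡id c (u ++ v))
  ... | p , q = cong₂ _,_ (Code-≡ p) (Code-≡ q)

Code-uncons : ∀ n → Code (suc n) ↔ (∃ λ k → k < 2 + n × Tail n k)
Code-uncons n = mk↔ₛ′
  (λ { (k ∷ w , k< , t) → k , k< , w , t })
  (λ { (k , k< , w , t) → k ∷ w , k< , t })
  (λ _ → refl)
  (λ { (_ ∷ _ , _) → refl })

-- Counting codes

Σ<-count : ∀ N {P : ℕ → Set} {f : ℕ → ℕ} → (∀ k → k < N → P k ↔ Fin (f k)) →
  (∃ λ k → k < N × P k) ↔ Fin (sum {N} (f ∘ toℕ))
Σ<-count zero    _   = mk↔ₛ′ (λ ()) (λ ()) (λ ()) (λ ())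
Σ<-count (suc N) {P} P↔f =
  ↔-sym +↔⊎ ↔-∘ ((P↔f 0 z<s ⊎-↔ Σ<-count N (λ k k<N → P↔f (suc k) (s<s k<N))) ↔-∘ split)
  where
  split : (∃ λ k → k < suc N × P k) ↔ (P 0 ⊎ ∃ λ k → k < N × P (suc k))
  split = mk↔ₛ′
    (λ { (zero , _ , p) → inj₁ p ; (suc k , s≤s k<N , p) → inj₂ (k , k<N , p) })
    (λ { (inj₁ p) → 0 , z<s , p ; (inj₂ (k , k<N , p)) → suc k , s<s k<N , p })
    (λ { (inj₁ _) → refl ; (inj₂ _) → refl })
    (λ { (zero , s≤s z≤n , _) → refl ; (suc _ , s≤s _ , _) → refl })

#tail : ℕ → ℕ → ℕ
#tail n zero    = 𝕊 n
#tail n (suc c) = 𝕊 c * 𝕊 (n ∸ c)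

-- The counts of codes are a hypothesis, so that the lemma applies inside the recursion that
-- establishes them. The entry 0 opens no window and admits any code behind it; after `suc c` the
-- tail splits into two independent codes.
Tail-count-from : ∀ n → (∀ m → m ≤ n → Code m ↔ Fin (𝕊 m)) →
  ∀ k → k < 2 + n → Tail n k ↔ Fin (#tail n k)
Tail-count-from n count zero _ = count n ≤-refl ↔-∘ mk↔ₛ′
  (λ { (w , _ , z) → w , z }) (λ { (w , z) → w , tt , z }) (λ _ → refl) (λ _ → refl)
Tail-count-from n count (suc c) (s≤s (s≤s c≤n)) =
  ↔-sym *↔× ↔-∘ ((count c c≤n ×-↔ count (n ∸ c) (m∸n≤m n c)) ↔-∘
    subst (λ m → Tail m (suc c) ↔ (Code c × Code (n ∸ c))) (m+[n∸m]≡n c≤n)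
      (Tail-split c (n ∸ c)))

Code-count : ∀ n → Code n ↔ Fin (𝕊 n)
Code-count = <-rec (λ n → Code n ↔ Fin (𝕊 n)) step
  where
  step : ∀ n → (∀ {m} → m < n → Code m ↔ Fin (𝕊 m)) → Code n ↔ Fin (𝕊 n)
  step zero    _   = mk↔ₛ′ (λ _ → zero) (λ _ → [] , tt)
    (λ { zero → refl }) (λ { ([] , tt) → refl })
  step (suc n) rec = subst (λ s → Code (suc n) ↔ Fin s) (sym (𝕊-recurrence n))
    -- The summand at 0 is `𝕊 n` and the others are those of `convolve 𝕊 n`, so the sum matches the
    -- recurrence by computation.
    (Σ<-count (2 + n) (Tail-count-from n (λ m m≤n → rec (s≤s m≤n))) ↔-∘ Code-uncons n)

Tail-count : ∀ n k → k < 2 + n → Tail n k ↔ Fin (#tail n k)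
Tail-count n = Tail-count-from n (λ m _ → Code-count m)

-- Encoding permutations

-- Opening a gap at or below a threshold raises the threshold by exactly one.
punchIn-< : ∀ {n} {p : Fin (suc n)} {a : Fin n} {t} →
  toℕ p ≤ t → toℕ a < t → toℕ (punchIn p a) < suc t
punchIn-< {p = zero}              _         a<t       = s<s a<t
punchIn-< {p = suc p} {a = zero}  _         _         = z<s
punchIn-< {p = suc p} {a = suc a} (s≤s p≤t) (s<s a<t) = s<s (punchIn-< p≤t a<t)

punchIn-<⁻ : ∀ {n} {p : Fin (suc n)} {a : Fin n} {t} →
  toℕ p ≤ t → toℕ (punchIn p a) < suc t → toℕ a < t
punchIn-<⁻ {p = zero}              _         (s<s a<t) = a<t
punchIn-<⁻ {p = suc p} {a = zero}  (s≤s _)   _         = z<s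
punchIn-<⁻ {p = suc p} {a = suc a} (s≤s p≤t) (s<s a<t) = s<s (punchIn-<⁻ p≤t a<t)

tailₚ : ∀ {n} → Permutation′ (suc n) → Permutation′ n
tailₚ = remove zero

module _ {n} (τ : Permutation′ (suc n)) where
  private
    head = τ ⟨$⟩ʳ zero

    suc-value : ∀ i → τ ⟨$⟩ʳ suc i ≡ punchIn head (tailₚ τ ⟨$⟩ʳ i)
    suc-value = punchIn-permute τ zero

  tail-< : ∀ {t} i → toℕ head ≤ t →
    toℕ (tailₚ τ ⟨$⟩ʳ i) < t → toℕ (τ ⟨$⟩ʳ suc i) < suc t
  tail-< {t} i h≤t lt = subst (λ v → toℕ v < suc t) (sym (suc-value i)) (punchIn-< h≤t lt)

  tail-<⁻ : ∀ {t} i → toℕ head ≤ t →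
    toℕ (τ ⟨$⟩ʳ suc i) < suc t → toℕ (tailₚ τ ⟨$⟩ʳ i) < t
  tail-<⁻ {t} i h≤t lt = punchIn-<⁻ h≤t (subst (λ v → toℕ v < suc t) (suc-value i) lt)

  tail-≥ : ∀ {t} i → toℕ head ≤ t →
    t ≤ toℕ (tailₚ τ ⟨$⟩ʳ i) → suc t ≤ toℕ (τ ⟨$⟩ʳ suc i)
  tail-≥ i h≤t ge = ≮⇒≥ λ lt → <⇒≱ (tail-<⁻ i h≤t lt) ge

  tail-≥⁻ : ∀ {t} i → toℕ head ≤ t →
    suc t ≤ toℕ (τ ⟨$⟩ʳ suc i) → t ≤ toℕ (tailₚ τ ⟨$⟩ʳ i)
  tail-≥⁻ i h≤t ge = ≮⇒≥ λ lt → <⇒≱ (tail-< i h≤t lt) ge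

  tail-<head : ∀ i → toℕ (tailₚ τ ⟨$⟩ʳ i) < toℕ head → (τ ⟨$⟩ʳ suc i) Fin.< head
  -- The threshold lemma gives only `≤`; equality fails because the gap lies at the first value
  -- itself.
  tail-<head i lt = ≤∧≢⇒< (s≤s⁻¹ (tail-< i ≤-refl lt))
    λ eq → punchInᵢ≢i head _ (trans (sym (suc-value i)) (toℕ-injective eq))

  tail-<head⁻ : ∀ i → (τ ⟨$⟩ʳ suc i) Fin.< head → toℕ (tailₚ τ ⟨$⟩ʳ i) < toℕ head
  tail-<head⁻ i lt = tail-<⁻ i ≤-refl (m<n⇒m<1+n lt)

  tail-mono : ∀ i j → (tailₚ τ ⟨$⟩ʳ i) Fin.< (tailₚ τ ⟨$⟩ʳ j) →
    (τ ⟨$⟩ʳ suc i) Fin.< (τ ⟨$⟩ʳ suc j)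
  tail-mono i j lt = ≰⇒> λ le → <⇒≱ lt
    (punchIn-cancel-≤ head _ _ (subst₂ Fin._≤_ (suc-value j) (suc-value i) le))

  tail-cancel : ∀ i j → (τ ⟨$⟩ʳ suc i) Fin.< (τ ⟨$⟩ʳ suc j) →
    (tailₚ τ ⟨$⟩ʳ i) Fin.< (tailₚ τ ⟨$⟩ʳ j)
  tail-cancel i j lt = ≰⇒> λ le → <⇒≱ lt
    (subst₂ Fin._≤_ (sym (suc-value j)) (sym (suc-value i)) (punchIn-mono-≤ head _ _ le))

-- This is the Lehmer code: at the first position all smaller values come later, so the 0-based
-- value is their number. Deleting the first entry and closing the gap keeps the counts at the other
-- positions.
encode : ∀ {n} → Permutation′ (suc n) → Vec ℕ n
encode {zero}  τ = []
encode {suc n} τ = toℕ (τ ⟨$⟩ʳ zero) ∷ encode (tailₚ τ)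

tail-cong : ∀ {n} (τ ρ : Permutation′ (suc n)) → τ ≈ ρ → tailₚ τ ≈ tailₚ ρ
tail-cong τ ρ τ≈ρ i = punchIn-injective (τ ⟨$⟩ʳ zero) _ _ (begin
  punchIn (τ ⟨$⟩ʳ zero) (tailₚ τ ⟨$⟩ʳ i) ≡⟨ punchIn-permute τ zero i ⟨
  τ ⟨$⟩ʳ suc i                           ≡⟨ τ≈ρ (suc i) ⟩
  ρ ⟨$⟩ʳ suc i                           ≡⟨ punchIn-permute ρ zero i ⟩
  punchIn (ρ ⟨$⟩ʳ zero) (tailₚ ρ ⟨$⟩ʳ i) ≡⟨ cong (λ h → punchIn h _) (τ≈ρ zero) ⟨
  punchIn (τ ⟨$⟩ʳ zero) (tailₚ ρ ⟨$⟩ʳ i) ∎)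
  where open ≡-Reasoning

uncons-cong : ∀ {n} (τ ρ : Permutation′ (suc n)) →
  τ ⟨$⟩ʳ zero ≡ ρ ⟨$⟩ʳ zero → tailₚ τ ≈ tailₚ ρ → τ ≈ ρ
uncons-cong τ ρ h t zero    = h
uncons-cong τ ρ h t (suc i) = trans (punchIn-permute τ zero i)
  (trans (cong₂ punchIn h (t i)) (sym (punchIn-permute ρ zero i)))

encode-cong : ∀ {n} (τ ρ : Permutation′ (suc n)) → τ ≈ ρ → encode τ ≡ encode ρ
encode-cong {zero}  τ ρ τ≈ρ = refl
encode-cong {suc n} τ ρ τ≈ρ =
  cong₂ _∷_ (cong toℕ (τ≈ρ zero)) (encode-cong (tailₚ τ) (tailₚ ρ) (tail-cong τ ρ τ≈ρ))

encode-injective : ∀ {n} (τ ρ : Permutation′ (suc n)) → encode τ ≡ encode ρ → τ ≈ ρ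
encode-injective {zero}  τ ρ _ i with τ ⟨$⟩ʳ i | ρ ⟨$⟩ʳ i
... | zero | zero = refl
encode-injective {suc n} τ ρ eq with h , t ← ∷-injective eq =
  uncons-cong τ ρ (toℕ-injective h) (encode-injective (tailₚ τ) (tailₚ ρ) t)

decode : ∀ {n} (w : Vec ℕ n) → Valid w → Permutation′ (suc n)
decode []      _            = Perm.id
decode (d ∷ w) (d< , _ , z) = insert zero (fromℕ< d<) (decode w z)

encode-decode : ∀ {n} (w : Vec ℕ n) (z : Valid w) → encode (decode w z) ≡ w
encode-decode []      _            = refl
encode-decode (d ∷ w) (d< , _ , z) = cong₂ _∷_ (toℕ-fromℕ< d<)
  (trans (encode-cong _ _ (remove-insert zero (fromℕ< d<) (decode w z))) (encode-decode w z))

-- Avoidance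

permute-injective : ∀ {n} (τ : Permutation′ n) {i j} → τ ⟨$⟩ʳ i ≡ τ ⟨$⟩ʳ j → i ≡ j
permute-injective τ eq =
  trans (sym (Perm.inverseˡ τ)) (trans (cong (τ ⟨$⟩ˡ_) eq) (Perm.inverseˡ τ))

-- Both patterns at once: the two low entries `k` and `l` are distinct, but their order is left open
-- in position and in value.
Avoiding : ∀ {n} → Permutation′ n → Set
Avoiding τ = ∀ i j k l → i Fin.< j → j Fin.< k → j Fin.< l → k ≢ l →
  (τ ⟨$⟩ʳ i) Fin.< (τ ⟨$⟩ʳ j) → (τ ⟨$⟩ʳ k) Fin.< (τ ⟨$⟩ʳ i) → (τ ⟨$⟩ʳ l) Fin.< (τ ⟨$⟩ʳ i) → ⊥

-- The instances of avoidance whose first entry is c and is followed by σ, whose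
-- values ≥ c stand for values > c.
AvoidingFrom : ∀ {n} → ℕ → Permutation′ n → Set
AvoidingFrom c σ = ∀ j k l → j Fin.< k → j Fin.< l → k ≢ l →
  c ≤ toℕ (σ ⟨$⟩ʳ j) → toℕ (σ ⟨$⟩ʳ k) < c → toℕ (σ ⟨$⟩ʳ l) < c → ⊥

-- If the first value were ≥ c + 2, the positions of the values 0 and 1 would both
-- lie behind it.
head-bound : ∀ {n} c (σ : Permutation′ (2 + n)) → AvoidingFrom (2 + c) σ →
  toℕ (σ ⟨$⟩ʳ zero) ≤ suc c
head-bound c σ avoids = ≮⇒≥ λ big → avoids zero (σ ⟨$⟩ˡ zero) (σ ⟨$⟩ˡ suc zero)
  (behind zero (<-≤-trans z<s big))
  (behind (suc zero) (<-≤-trans (s<s z<s) big))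
  (λ eq → 0≢1+n (trans (sym (Perm.inverseʳ σ)) (trans (cong (σ ⟨$⟩ʳ_) eq) (Perm.inverseʳ σ))))
  big
  (subst (λ v → toℕ v < 2 + c) (sym (Perm.inverseʳ σ)) z<s)
  (subst (λ v → toℕ v < 2 + c) (sym (Perm.inverseʳ σ)) (s<s z<s))
  where
  behind : ∀ v → v Fin.< (σ ⟨$⟩ʳ zero) → zero {1} Fin.< (σ ⟨$⟩ˡ v)
  behind v v< with σ ⟨$⟩ˡ v in eq
  ... | suc _ = z<s
  ... | zero  = contradiction
    (cong toℕ (trans (sym (Perm.inverseʳ σ)) (cong (σ ⟨$⟩ʳ_) eq))) (<⇒≢ v<)

-- While at least two values lie below the threshold, `head-bound` forces the next entry to be one
-- of them. Deleting it lowers the threshold by one, which yields the descending bounds; at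
-- threshold 0 or 1 nothing is demanded. By `c ≤ suc n` the code is long enough.
AvoidingFrom⇒Bounded : ∀ {n} c (σ : Permutation′ (suc n)) → c ≤ suc n →
  AvoidingFrom c σ → Bounded (pred c) (encode σ)
AvoidingFrom⇒Bounded         zero          σ _           _      = tt
AvoidingFrom⇒Bounded         (suc zero)    σ _           _      = tt
AvoidingFrom⇒Bounded {zero}  (suc (suc c)) σ (s≤s ())    _
AvoidingFrom⇒Bounded {suc n} (suc (suc c)) σ (s≤s c≤n)   avoids =
  h , AvoidingFrom⇒Bounded (suc c) (tailₚ σ) c≤n
    (λ j k l j<k j<l k≢l j≥ k< l< →
      avoids (suc j) (suc k) (suc l) (s<s j<k) (s<s j<l) (k≢l ∘ suc-injective)
        (tail-≥ σ j h j≥) (tail-< σ k h k<) (tail-< σ l h l<))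
  where
  h = head-bound c σ avoids

Bounded⇒AvoidingFrom : ∀ {n} c (σ : Permutation′ (suc n)) →
  Bounded (pred c) (encode σ) → AvoidingFrom c σ
Bounded⇒AvoidingFrom zero σ _ j k l _ _ _ _ () _
-- Only the value 0 lies below the threshold 1, and two positions cannot share it.
Bounded⇒AvoidingFrom (suc zero) σ _ j k l _ _ k≢l _ k< l< =
  k≢l (permute-injective σ (toℕ-injective (trans (n<1⇒n≡0 k<) (sym (n<1⇒n≡0 l<)))))
-- The first entry lies below the threshold and cannot be the large entry `j`; otherwise all three
-- positions lie in the tail.
Bounded⇒AvoidingFrom {suc n} (suc (suc c)) σ (h , _) zero k l _ _ _ j≥ _ _ = <⇒≱ j≥ h
Bounded⇒AvoidingFrom {suc n} (suc (suc c)) σ (h , b) (suc j) (suc k) (suc l)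
  (s<s j<k) (s<s j<l) k≢l j≥ k< l< =
  Bounded⇒AvoidingFrom (suc c) (tailₚ σ) b j k l j<k j<l (k≢l ∘ cong suc)
    (tail-≥⁻ σ j h j≥) (tail-<⁻ σ k h k<) (tail-<⁻ σ l h l<)

-- A forbidden configuration either starts at the first entry, which is the case of `AvoidingFrom`,
-- or lies in the tail, where deletion preserves the order.
Avoiding⇒Valid : ∀ {n} (τ : Permutation′ (suc n)) → Avoiding τ → Valid (encode τ)
Avoiding⇒Valid {zero}  τ _      = tt
Avoiding⇒Valid {suc n} τ avoids =
  toℕ<n _ ,
  AvoidingFrom⇒Bounded (toℕ (τ ⟨$⟩ʳ zero)) (tailₚ τ) (s≤s⁻¹ (toℕ<n _))
    (λ j k l j<k j<l k≢l j≥ k< l< →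
      avoids zero (suc j) (suc k) (suc l) z<s (s<s j<k) (s<s j<l) (k≢l ∘ suc-injective)
        (tail-≥ τ j ≤-refl j≥) (tail-<head τ k k<) (tail-<head τ l l<)) ,
  Avoiding⇒Valid (tailₚ τ)
    (λ i j k l i<j j<k j<l k≢l ij ki li →
      avoids (suc i) (suc j) (suc k) (suc l) (s<s i<j) (s<s j<k) (s<s j<l) (k≢l ∘ suc-injective)
        (tail-mono τ i j ij) (tail-mono τ k i ki) (tail-mono τ l i li))

Valid⇒Avoiding : ∀ {n} (τ : Permutation′ (suc n)) → Valid (encode τ) → Avoiding τ
Valid⇒Avoiding {zero}  τ _ zero zero _ _ ()
Valid⇒Avoiding {suc n} τ (_ , b , z) zero (suc j) (suc k) (suc l)
  _ (s<s j<k) (s<s j<l) k≢l ij ki li =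
  Bounded⇒AvoidingFrom (toℕ (τ ⟨$⟩ʳ zero)) (tailₚ τ) b j k l j<k j<l (k≢l ∘ cong suc)
    (tail-≥⁻ τ j ≤-refl ij) (tail-<head⁻ τ k ki) (tail-<head⁻ τ l li)
Valid⇒Avoiding {suc n} τ (_ , b , z) (suc i) (suc j) (suc k) (suc l)
  (s<s i<j) (s<s j<k) (s<s j<l) k≢l ij ki li =
  Valid⇒Avoiding (tailₚ τ) z i j k l i<j j<k j<l (k≢l ∘ cong suc)
    (tail-cancel τ i j ij) (tail-cancel τ k i ki) (tail-cancel τ l i li)

-- Containment of the two patterns

AllPairs₄ : (Fin 4 → Fin 4 → Set) → Set
AllPairs₄ R =
  R (# 0) (# 1) × R (# 0) (# 2) × R (# 0) (# 3) × R (# 1) (# 2) × R (# 1) (# 3) × R (# 2) (# 3)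

allPairs₄ : ∀ {R} → AllPairs₄ R → ∀ a b → a Fin.< b → R a b
allPairs₄ (r , _) zero (suc zero) _ = r
allPairs₄ (_ , r , _) zero (suc (suc zero)) _ = r
allPairs₄ (_ , _ , r , _) zero (suc (suc (suc zero))) _ = r
allPairs₄ (_ , _ , _ , r , _) (suc zero) (suc (suc zero)) _ = r
allPairs₄ (_ , _ , _ , _ , r , _) (suc zero) (suc (suc (suc zero))) _ = r
allPairs₄ (_ , _ , _ , _ , _ , r) (suc (suc zero)) (suc (suc (suc zero))) _ = r
allPairs₄ _ (suc zero) (suc zero) (s<s ())
allPairs₄ _ (suc (suc zero)) (suc zero) (s<s ())
allPairs₄ _ (suc (suc zero)) (suc (suc zero)) (s<s (s<s ()))
allPairs₄ _ (suc (suc (suc zero))) (suc zero) (s<s ())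
allPairs₄ _ (suc (suc (suc zero))) (suc (suc zero)) (s<s (s<s ()))
allPairs₄ _ (suc (suc (suc zero))) (suc (suc (suc zero))) (s<s (s<s (s<s ())))

-- The hypotheses on `σ` record what 3412 and 3421 share: an ascent, then two entries not above its
-- lower end.
Avoiding⇒Avoids : ∀ {n} (τ : Permutation′ n) (σ : Permutation′ 4) →
  (σ ⟨$⟩ʳ # 0) Fin.< (σ ⟨$⟩ʳ # 1) →
  ¬ (σ ⟨$⟩ʳ # 0) Fin.< (σ ⟨$⟩ʳ # 2) → ¬ (σ ⟨$⟩ʳ # 0) Fin.< (σ ⟨$⟩ʳ # 3) →
  Avoiding τ → Avoids τ σ
Avoiding⇒Avoids τ σ up down₂ down₃ avoids (ι , mono , iff) =
  avoids (ι (# 0)) (ι (# 1)) (ι (# 2)) (ι (# 3))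
    (mono (# 0) (# 1) z<s) (mono (# 1) (# 2) (s<s z<s)) (mono (# 1) (# 3) (s<s z<s))
    (<⇒≢ (mono (# 2) (# 3) (s<s (s<s z<s))) ∘ cong toℕ)
    (Equivalence.from (iff (# 0) (# 1) z<s) up) (below (# 2) z<s down₂) (below (# 3) z<s down₃)
  where
  below : ∀ b → zero {3} Fin.< b → ¬ (σ ⟨$⟩ʳ # 0) Fin.< (σ ⟨$⟩ʳ b) →
    (τ ⟨$⟩ʳ ι b) Fin.< (τ ⟨$⟩ʳ ι (# 0))
  -- Containment gives only `≤` here; injectivity of `τ` makes it strict.
  below b 0<b ¬up = ≤∧≢⇒< (≮⇒≥ (¬up ∘ Equivalence.to (iff (# 0) b 0<b)))
    λ eq → <⇒≢ (mono (# 0) b 0<b) (cong toℕ (sym (permute-injective τ (toℕ-injective eq))))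

both : ∀ {A B : Set} → A → B → A ⇔ B
both a b = mk⇔ (λ _ → b) (λ _ → a)

neither : ∀ {A B : Set} → ¬ A → ¬ B → A ⇔ B
neither ¬a ¬b = mk⇔ (λ a → contradiction a ¬a) (λ b → contradiction b ¬b)

lookup-increasing₄ : ∀ {n} {i j k l : Fin n} → i Fin.< j → j Fin.< k → k Fin.< l →
  ∀ a b → a Fin.< b → lookup (i ∷ j ∷ k ∷ l ∷ []) a Fin.< lookup (i ∷ j ∷ k ∷ l ∷ []) b
lookup-increasing₄ i<j j<k k<l = allPairs₄
  (i<j , <-trans i<j j<k , <-trans i<j (<-trans j<k k<l) , j<k , <-trans j<k k<l , k<l)

module _ {n} (τ : Permutation′ n)
  (avoids₁ : Avoids τ (proj₂ p3412)) (avoids₂ : Avoids τ (proj₂ p3421)) where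

  -- The comparison of the two low values decides which of the two patterns occurs.
  Avoids⇒Avoiding-ordered : ∀ i j k l → i Fin.< j → j Fin.< k → k Fin.< l →
    (τ ⟨$⟩ʳ i) Fin.< (τ ⟨$⟩ʳ j) → (τ ⟨$⟩ʳ k) Fin.< (τ ⟨$⟩ʳ i) → (τ ⟨$⟩ʳ l) Fin.< (τ ⟨$⟩ʳ i) → ⊥
  Avoids⇒Avoiding-ordered i j k l i<j j<k k<l ij ki li
    with <-cmp (toℕ (τ ⟨$⟩ʳ k)) (toℕ (τ ⟨$⟩ʳ l))
  ... | tri< kl _ _ = avoids₁ (lookup (i ∷ j ∷ k ∷ l ∷ []) , lookup-increasing₄ i<j j<k k<l , allPairs₄
    ( both ij (from-yes (2 <? 3)) , neither (<-asym ki) (λ ()) , neither (<-asym li) (λ { (s<s ()) })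
    , neither (<-asym (<-trans ki ij)) (λ ()) , neither (<-asym (<-trans li ij)) (λ { (s<s ()) })
    , both kl z<s))
  ... | tri≈ _ kl _ =
    <⇒≢ k<l (cong toℕ (permute-injective τ (toℕ-injective kl)))
  ... | tri> _ _ lk = avoids₂ (lookup (i ∷ j ∷ k ∷ l ∷ []) , lookup-increasing₄ i<j j<k k<l , allPairs₄
    ( both ij (from-yes (2 <? 3)) , neither (<-asym ki) (λ { (s<s ()) }) , neither (<-asym li) (λ ())
    , neither (<-asym (<-trans ki ij)) (λ { (s<s ()) }) , neither (<-asym (<-trans li ij)) (λ ())
    , neither (<-asym lk) (λ ())))

  Avoids⇒Avoiding : Avoiding τ
  Avoids⇒Avoiding i j k l i<j j<k j<l k≢l ij ki li with <-cmp (toℕ k) (toℕ l)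
  ... | tri< k<l _ _ = Avoids⇒Avoiding-ordered i j k l i<j j<k k<l ij ki li
  ... | tri≈ _ k≡l _ = k≢l (toℕ-injective k≡l)
  ... | tri> _ _ l<k = Avoids⇒Avoiding-ordered i j l k i<j j<l l<k ij li ki

-- Counting avoiders with a given first value

S-encode : ∀ n k → k < 2 + n →
  Inverse (S (2 + n) (suc k) (p3412 ∷ p3421 ∷ [])) (setoid (Tail n k))
S-encode n k k< = record
  { to        = to
  ; from      = from
  ; to-cong   = λ {x} {y} → to-cong {x} {y}
  ; from-cong = λ { refl _ → refl }
  ; inverse   =
      (λ {x} {y} y≈ → trans (to-cong {y} {from x} y≈) (to-from x)) ,
      (λ { {x} refl → from-to x })
  }
  where
  open Setoid (S (2 + n) (suc k) (p3412 ∷ p3421 ∷ [])) using (Carrier) renaming (_≈_ to _≋_)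

  head≡k : ((τ , _) : Carrier) → toℕ (τ ⟨$⟩ʳ zero) ≡ k
  head≡k (_ , (zero , _ , eq) , _) = cong pred eq

  valid : ((τ , _) : Carrier) → Valid (encode τ)
  valid (τ , _ , avoids₁ ∷ avoids₂ ∷ []) = Avoiding⇒Valid τ (Avoids⇒Avoiding τ avoids₁ avoids₂)

  to : Carrier → Tail n k
  to x with _ , b , z ← valid x =
    encode (tailₚ (proj₁ x)) ,
    subst (λ h → Bounded (pred h) (encode (tailₚ (proj₁ x)))) (head≡k x) b , z

  from : Tail n k → Carrier
  from (w , b , z) = τ , (zero , refl , cong suc (toℕ-fromℕ< k<)) ,
      Avoiding⇒Avoids τ (proj₂ p3412) (from-yes (2 <? 3)) (λ ()) (λ { (s<s ()) }) avoiding ∷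
      Avoiding⇒Avoids τ (proj₂ p3421) (from-yes (2 <? 3)) (λ { (s<s ()) }) (λ ()) avoiding ∷ []
    where
    τ = decode (k ∷ w) (k< , b , z)
    avoiding = Valid⇒Avoiding τ
      (subst Valid (sym (encode-decode (k ∷ w) (k< , b , z))) (k< , b , z))

  to-cong : ∀ {x y} → x ≋ y → to x ≡ to y
  to-cong {x} {y} x≈y = Tail-≡ {k = k}
    (encode-cong (tailₚ (proj₁ x)) (tailₚ (proj₁ y)) (tail-cong (proj₁ x) (proj₁ y) x≈y))

  encode-from : ∀ t → encode (proj₁ (from t)) ≡ k ∷ proj₁ t
  encode-from (w , b , z) = encode-decode (k ∷ w) (k< , b , z)

  to-from : ∀ t → to (from t) ≡ t
  to-from t = Tail-≡ {k = k} (proj₂ (∷-injective (encode-from t)))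

  from-to : ∀ x → from (to x) ≋ x
  from-to x = encode-injective (proj₁ (from (to x))) (proj₁ x)
    (trans (encode-from (to x)) (cong (_∷ encode (tailₚ (proj₁ x))) (sym (head≡k x))))

S-count : ∀ n k → k < 2 + n → ∣ S (2 + n) (suc k) (p3412 ∷ p3421 ∷ []) ∣≡ #tail n k
S-count n k k< = inverse (S-encode n k k<) (Tail-count n k k<)

theorem6p2 : (∀ (n r : ℕ) → 2 ≤ n → r ≡ 1 ⊎ r ≡ 2 ⊎ r ≡ n →
    ∣ S n r (p3412 ∷ p3421 ∷ []) ∣≡ 𝕊 (n ∸ 2))
    ×
    (∀ (n r : ℕ) → 4 ≤ n → 2 < r → r < n →
    ∣ S n r (p3412 ∷ p3421 ∷ []) ∣≡ (𝕊 (r ∸ 2) * 𝕊 (n ∸ r)))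
theorem6p2 = extreme , middle
  where
  extreme : ∀ (n r : ℕ) → 2 ≤ n → r ≡ 1 ⊎ r ≡ 2 ⊎ r ≡ n →
    ∣ S n r (p3412 ∷ p3421 ∷ []) ∣≡ 𝕊 (n ∸ 2)
  extreme (suc (suc n)) _ (s≤s (s≤s _)) (inj₁ refl) = S-count n 0 z<s
  -- Since `𝕊 0` computes to 1, the first factor of `#tail` disappears for r = 2 and the second for
  -- r = n.
  extreme (suc (suc n)) _ (s≤s (s≤s _)) (inj₂ (inj₁ refl)) =
    subst (∣ S (2 + n) 2 (p3412 ∷ p3421 ∷ []) ∣≡_) (*-identityˡ (𝕊 n)) (S-count n 1 (s<s z<s))
  extreme (suc (suc n)) _ (s≤s (s≤s _)) (inj₂ (inj₂ refl)) =
    subst (∣ S (2 + n) (2 + n) (p3412 ∷ p3421 ∷ []) ∣≡_)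
      (trans (cong (λ m → 𝕊 n * 𝕊 m) (n∸n≡0 n)) (*-identityʳ (𝕊 n))) (S-count n (suc n) ≤-refl)

  middle : ∀ (n r : ℕ) → 4 ≤ n → 2 < r → r < n →
    ∣ S n r (p3412 ∷ p3421 ∷ []) ∣≡ (𝕊 (r ∸ 2) * 𝕊 (n ∸ r))
  -- With r = c + 2 the 0-based first value is `suc c`, and both truncated differences reduce to
  -- those in `#tail`.
  middle (suc (suc n)) (suc (suc c)) (s≤s (s≤s _)) (s<s (s<s _)) (s<s (s<s c<n)) =
    S-count n (suc c) (s<s (s<s (<⇒≤ c<n)))
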